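{- For every integer $r\equiv 1\pmod 4$ with $r\ge 9$, the digraph $\mathcal C_4(r)$ has a $4$-layer balanced Hamilton starter $H$ whose translates $H, H+4, H+8,\ldots,H+4(r-1)$ form a Hamilton decomposition of $\mathcal C_4(r)$ (i.e. they are Hamilton cycles whose arc sets partition the arc set of $\mathcal C_4(r)$), and every one of these developed cycles has winding number $(r+1)/2$.
   Context: For $r\ge1$ let $[r]=\{1,\ldots,r\}$. For $q\ge 3$, $\mathcal C_q(r)$ denotes the directed Cayley digraph on $\mathbb Z_{qr}$ with arcs $x\to x+s$ for all $x\in\mathbb Z_{qr}$, $s\in[r]$. The arc $x\to x+s$ has tail $x$ and step $s$. A $q$-layer balanced Hamilton starter of $\mathcal C_q(r)$ is a directed Hamilton cycle $H$ of $\mathcal C_q(r)$ such that for every $(j,s)\in\mathbb Z_q\times[r]$ it contains exactly one arc of step $s$ whose tail is congruent to $j$ modulo $q$. For an integer $c$, $H+c$ is the image of $H$ under $x\mapsto x+c$. The winding number of a closed directed walk $H$ in $\mathcal C_q(r)$ is $\omega(H)=\frac1{qr}\sum_{e\in H}s(e)$, where $s(e)\in[r]$ is the step of $e$ as a positive integer and arcs are counted with multiplicity. -}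

module Defs where

open import Algebra.Properties.Monoid.Sum using (sum)
open import Data.Fin using (Fin; toℕ; fromℕ<)
open import Data.Integer using (ℤ; +_) renaming (_+_ to _+ᶻ_)
open import Data.Integer.DivMod using (_%ℕ_; n%ℕd<d)
open import Data.Nat using (ℕ; suc; _*_; _%_; NonZero)
open import Data.Nat.DivMod using (_mod_)
open import Data.Nat.Properties using (m*n≢0; +-0-monoid)
open import Data.Product using (_×_; ∃; ∃!)
open import Data.Rational using (ℚ; _/_)
open import Data.Vec.Functional using (Vector)
open import Function using (_∘_)
open import Function.Definitions using (Bijective)
open import Relation.Binary.PropositionalEquality using (_≡_)

-- ℤ_n is represented by Fin n; x ⊕ a adds the residue class of the integer a.
infixl 6 _⊕_
_⊕_ : ∀ {n} .{{_ : NonZero n}} → Fin n → ℤ → Fin n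
_⊕_ {n} x a = fromℕ< (n%ℕd<d (+ toℕ x +ᶻ a) n)

-- Cyclic successor on the indices of a closed sequence.
next : ∀ {m} → Fin m → Fin m
next {suc m} i = suc (toℕ i) mod suc m

Vertex : ℕ → ℕ → Set
Vertex q r = Fin (q * r)

-- The arcs of C_q(r), x → x + s, are in bijection with the pairs (x , s):
-- distinct elements of [r] are distinct modulo q r.
-- The index i : Fin r stands for the element suc (toℕ i) of [r] = {1,…,r}.
record Arc (q r : ℕ) : Set where
  constructor arc
  field
    tail      : Vertex q r
    stepIndex : Fin r

  step : ℕ
  step = suc (toℕ stepIndex)

open Arc public

module _ {q r : ℕ} .{{_ : NonZero q}} .{{_ : NonZero r}} where

  private
    instance
      qr≢0 : NonZero (q * r)
      qr≢0 = m*n≢0 q r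

  head : Arc q r → Vertex q r
  head e = tail e ⊕ + step e

  -- Subdigraphs are given by sequences of arcs in order of traversal.
  infix 4 _∈ᵃ_
  _∈ᵃ_ : ∀ {m} → Arc q r → Vector (Arc q r) m → Set
  e ∈ᵃ W = ∃ λ i → W i ≡ e

  IsClosedWalk : ∀ {m} → Vector (Arc q r) m → Set
  IsClosedWalk W = ∀ i → head (W i) ≡ tail (W (next i))

  -- A closed walk leaving every vertex exactly once.
  IsHamiltonCycle : Vector (Arc q r) (q * r) → Set
  IsHamiltonCycle H = IsClosedWalk H × Bijective _≡_ _≡_ (tail ∘ H)

  IsBalancedStarter : Vector (Arc q r) (q * r) → Set
  IsBalancedStarter H =
    IsHamiltonCycle H ×
    (∀ (j : Fin q) (s : Fin r) →
       ∃! _≡_ λ e → e ∈ᵃ H × stepIndex e ≡ s × toℕ (tail e) % q ≡ toℕ j)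

  -- The image of the arc x → x + s under translation by c is x + c → x + c + s.
  infixl 6 _+ᴴ_
  _+ᴴ_ : ∀ {m} → Vector (Arc q r) m → ℤ → Vector (Arc q r) m
  (W +ᴴ c) i = arc (tail (W i) ⊕ c) (stepIndex (W i))

  IsHamiltonDecomposition : ∀ {k} → (Fin k → Vector (Arc q r) (q * r)) → Set
  IsHamiltonDecomposition Hs =
    (∀ i → IsHamiltonCycle (Hs i)) × (∀ e → ∃! _≡_ λ i → e ∈ᵃ Hs i)

  ω : ∀ {m} → Vector (Arc q r) m → ℚ
  ω W = + sum +-0-monoid (step ∘ W) / (q * r)

{-# OPTIONS --safe #-}
module Submission where

-- If a closed walk with 4 r arcs leaves every vertex and realises every pair (residue of the tail mod 4,
-- step), then by counting it does so exactly once.  Hence its translates by multiples of 4 partition the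
-- arcs, and its winding number is the average (r + 1) / 2 of all steps.
--
-- Such walks are built for r = 8 L + r₀ with r₀ ∈ {5, 9}.  Take a Hamilton starter of C_4(r₀), cut each
-- residue class mod 4 at four places and insert two blocks of L vertices at each cut.  A step s of the
-- small starter is kept, or becomes s + 8 L when it jumps over the two blocks at a cut.  The 32 blocks
-- are divided between two runs A and B.  A run goes L times around its blocks, visiting one vertex of
-- each per round; from one round to the next the tails move by ±4, with signs alternating along the
-- round, so the steps change by ±8 and each block uses up L consecutive steps of one class mod 8.
-- After A and B follow the 4 r₀ arcs X inherited from the small starter.  Everything is linear in the
-- round number and in L, so all conditions reduce to finite checks on coefficients.

open import Defs
open import Algebra.Properties.CommutativeMonoid.Sum using (sum-permute)
open import Algebra.Properties.Monoid.Sum using (sum; sum-cong-≗)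
open import Data.Bool using (T)
open import Data.Fin using (Fin; zero; suc; toℕ; fromℕ<; cast; combine; remQuot; punchOut; _↑ˡ_; _↑ʳ_)
open import Data.Fin.Patterns using (0F; 1F; 2F; 3F)
open import Data.Fin.Properties as Fin using (any?; toℕ-injective; toℕ-fromℕ<; toℕ<n; toℕ-cast; injective⇒≤; punchOut-injective; combine-surjective; remQuot-combine)
open import Data.Integer using (+_)
import Data.Integer.Properties as ℤ
open import Data.List using (List; []; _∷_; _++_; map; length; lookup)
import Data.List.Membership.DecPropositional as DecMembership
open import Data.List.Membership.Propositional using (_∈_)
open import Data.List.Membership.Propositional.Properties using (∈-++⁺ˡ; ∈-++⁺ʳ; ∈-++⁻; ∈-map⁺; ∈-map⁻; ∈-lookup)
open import Data.List.Properties using (length-++; length-map)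
open import Data.List.Relation.Unary.All as All using (All; []; all?)
import Data.List.Relation.Unary.All.Properties as All
open import Data.List.Relation.Unary.Any using (index)
open import Data.List.Relation.Unary.Any.Properties using (lookup-index)
open import Data.Maybe as Maybe using (Maybe; just; nothing; is-just; to-witness-T; _<∣>_; _>>=_)
open import Data.Nat using (ℕ; zero; suc; _+_; _*_; _∸_; _%_; _≤_; _<_; NonZero; z≤n; s≤s; _≟_; _≤?_; _<?_)
open import Data.Nat.Divisibility using (m∣m*n)
open import Data.Nat.DivMod using (_div_; _mod_; m≡m%n+[m/n]*n; m%n%n≡m%n; n%n≡0; m%n<n; m<n⇒m%n≡m; [m+n]%n≡m%n; [m+kn]%n≡m%n; %-distribˡ-+; m∣n⇒o%n%m≡o%m; m<n*o⇒m/o<n)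
open import Data.Nat.Properties hiding (_≟_; _≤?_; _<?_)
open import Data.Nat.Tactic.RingSolver using (solve-∀)
open import Data.Product using (Σ-syntax; ∃-syntax; ∃!; ∃₂; _×_; _,_; proj₁; proj₂)
open import Data.Product.Properties using (≡-dec)
open import Data.Rational using (_/_)
open import Data.Rational.Properties using (fromℚᵘ-cong)
open import Data.Rational.Unnormalised using (mkℚᵘ; *≡*)
open import Data.Sum using (_⊎_; inj₁; inj₂)
open import Data.Vec.Functional using (Vector)
open import Function using (_∘_; StrictlySurjective; Injective; mk⤖)
open import Function.Consequences.Propositional using (strictlySurjective⇒surjective)
open import Function.Properties.Bijection using (⤖⇒↔)
open import Relation.Binary using (DecidableEquality)
open import Relation.Binary.PropositionalEquality
open import Relation.Nullary using (Dec; yes; no; contradiction)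
open import Relation.Nullary.Decidable using (_×-dec_; _⊎-dec_; toWitness; dec⇒maybe; T?)

-- Self-maps of a finite set.

injective⇒strictlySurjective : ∀ {n} {f : Fin n → Fin n} → Injective _≡_ _≡_ f → StrictlySurjective _≡_ f
injective⇒strictlySurjective {zero} inj ()
injective⇒strictlySurjective {suc n} {f} inj y with any? (λ x → f x Fin.≟ y)
... | yes hit = hit
-- Removing the missed value `y` from the codomain would inject `suc n` points into `n`.
... | no miss = contradiction (injective⇒≤ {f = λ x → punchOut (y≢f x)} λ {a} {b} → inj ∘ punchOut-injective (y≢f a) (y≢f b)) 1+n≰n
  where
  y≢f : ∀ x → y ≢ f x
  y≢f x y≡fx = miss (x , sym y≡fx)

-- A chosen section is injective, hence onto by pigeonhole, hence a two-sided inverse.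
strictlySurjective⇒injective : ∀ {n} {f : Fin n → Fin n} → StrictlySurjective _≡_ f → Injective _≡_ _≡_ f
strictlySurjective⇒injective {n} {f} surj {x} {y} fx≡fy =
  trans (sym (section-f x)) (trans (cong section fx≡fy) (section-f y))
  where
  section : Fin n → Fin n
  section = proj₁ ∘ surj

  f-section : ∀ y → f (section y) ≡ y
  f-section = proj₂ ∘ surj

  section-injective : Injective _≡_ _≡_ section
  section-injective {a} {b} eq = trans (sym (f-section a)) (trans (cong f eq) (f-section b))

  section-f : ∀ x → section (f x) ≡ x
  section-f x with a , refl ← injective⇒strictlySurjective section-injective x =
    cong section (f-section a)

-- Finite sums and equality of fractions.

∑ : ∀ {n} → Vector ℕ n → ℕ
∑ = sum +-0-monoid

∑-↑ : ∀ m {n} (f : Vector ℕ (m + n)) → ∑ f ≡ ∑ (f ∘ (_↑ˡ n)) + ∑ (f ∘ (m ↑ʳ_))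
∑-↑ zero    f = refl
∑-↑ (suc m) f = trans (cong (λ k → f zero + k) (∑-↑ m (f ∘ suc))) (sym (+-assoc (f zero) _ _))

∑-combine : ∀ m {n} (f : Vector ℕ (m * n)) (g : Vector ℕ n) →
  (∀ (j : Fin m) (s : Fin n) → f (combine j s) ≡ g s) → ∑ f ≡ m * ∑ g
∑-combine zero    f g eq = refl
∑-combine (suc m) {n} f g eq = trans (∑-↑ n f)
  (cong₂ _+_ (sum-cong-≗ +-0-monoid (eq zero)) (∑-combine m (f ∘ (n ↑ʳ_)) g λ j → eq (suc j)))

∑-suc∘ : ∀ {n} (f : Vector ℕ n) → ∑ (suc ∘ f) ≡ n + ∑ f
∑-suc∘ {zero}  f = refl
∑-suc∘ {suc n} f = cong suc (trans (cong (λ k → f zero + k) (∑-suc∘ (f ∘ suc))) (lemma (f zero) n (∑ (f ∘ suc))))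
  where
  lemma : ∀ a b c → a + (b + c) ≡ b + (a + c)
  lemma = solve-∀

2*∑suc∘toℕ : ∀ n → 2 * ∑ (suc ∘ toℕ {n}) ≡ n * (n + 1)
2*∑suc∘toℕ zero    = refl
2*∑suc∘toℕ (suc n) = begin
  2 * suc (∑ (λ i → suc (suc (toℕ {n} i)))) ≡⟨ cong (λ k → 2 * suc k) (∑-suc∘ (suc ∘ toℕ {n})) ⟩
  2 * suc (n + ∑ (suc ∘ toℕ {n}))           ≡⟨ lemma₁ n (∑ (suc ∘ toℕ {n})) ⟩
  2 + 2 * n + 2 * ∑ (suc ∘ toℕ {n})         ≡⟨ cong (λ k → 2 + 2 * n + k) (2*∑suc∘toℕ n) ⟩
  2 + 2 * n + n * (n + 1)                   ≡⟨ lemma₂ n ⟩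
  suc n * (suc n + 1)                       ∎
  where
  open ≡-Reasoning
  lemma₁ : ∀ n s → 2 * suc (n + s) ≡ 2 + 2 * n + 2 * s
  lemma₁ = solve-∀
  lemma₂ : ∀ n → 2 + 2 * n + n * (n + 1) ≡ suc n * (suc n + 1)
  lemma₂ = solve-∀

/-cross : ∀ a b c d .{{_ : NonZero b}} .{{_ : NonZero d}} → a * d ≡ c * b → + a / b ≡ + c / d
/-cross a (suc b) c (suc d) eq = fromℚᵘ-cong {mkℚᵘ (+ a) b} {mkℚᵘ (+ c) d}
  (*≡* (trans (sym (ℤ.pos-* a (suc d))) (trans (cong +_ eq) (ℤ.pos-* c (suc b)))))

-- Translations of the cyclic group.

%-absorbˡ : ∀ a b n .{{_ : NonZero n}} → (a % n + b) % n ≡ (a + b) % n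
%-absorbˡ a b n = begin
  (a % n + b) % n         ≡⟨ %-distribˡ-+ (a % n) b n ⟩
  (a % n % n + b % n) % n ≡⟨ cong (λ k → (k + b % n) % n) (m%n%n≡m%n a n) ⟩
  (a % n + b % n) % n     ≡⟨ %-distribˡ-+ a b n ⟨
  (a + b) % n             ∎
  where open ≡-Reasoning

module _ {n : ℕ} .{{_ : NonZero n}} where

  toℕ-⊕ : ∀ (x : Fin n) a → toℕ (x ⊕ + a) ≡ (toℕ x + a) % n
  toℕ-⊕ x a = toℕ-fromℕ< _

  ⊕-assoc : ∀ (x : Fin n) a b → x ⊕ + a ⊕ + b ≡ x ⊕ + (a + b)
  ⊕-assoc x a b = toℕ-injective (begin
    toℕ (x ⊕ + a ⊕ + b)       ≡⟨ toℕ-⊕ (x ⊕ + a) b ⟩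
    (toℕ (x ⊕ + a) + b) % n   ≡⟨ cong (λ k → (k + b) % n) (toℕ-⊕ x a) ⟩
    ((toℕ x + a) % n + b) % n ≡⟨ %-absorbˡ (toℕ x + a) b n ⟩
    (toℕ x + a + b) % n       ≡⟨ cong (_% n) (+-assoc (toℕ x) a b) ⟩
    (toℕ x + (a + b)) % n     ≡⟨ toℕ-⊕ x (a + b) ⟨
    toℕ (x ⊕ + (a + b))       ∎)
    where open ≡-Reasoning

  ⊕-comm : ∀ (x : Fin n) a b → x ⊕ + a ⊕ + b ≡ x ⊕ + b ⊕ + a
  ⊕-comm x a b = trans (⊕-assoc x a b) (trans (cong (λ k → x ⊕ + k) (+-comm a b)) (sym (⊕-assoc x b a)))

  ⊕-multiple : ∀ (x : Fin n) k → x ⊕ + (k * n) ≡ x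
  ⊕-multiple x k = toℕ-injective (trans (toℕ-⊕ x (k * n))
    (trans ([m+kn]%n≡m%n (toℕ x) k n) (m<n⇒m%n≡m (toℕ<n x))))

  ⊕-strictlySurjective : ∀ a → StrictlySurjective _≡_ (λ (x : Fin n) → x ⊕ + a)
  -- `a * (n ∸ 1)` represents the inverse of `a` modulo `n` by a natural number.
  ⊕-strictlySurjective a y = y ⊕ + (a * (n ∸ 1)) , (begin
    y ⊕ + (a * (n ∸ 1)) ⊕ + a ≡⟨ ⊕-assoc y (a * (n ∸ 1)) a ⟩
    y ⊕ + (a * (n ∸ 1) + a)   ≡⟨ cong (λ k → y ⊕ + k) (lemma n) ⟩
    y ⊕ + (a * n)             ≡⟨ ⊕-multiple y a ⟩
    y                         ∎)
    where
    open ≡-Reasoning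
    lemma : ∀ n .{{_ : NonZero n}} → a * (n ∸ 1) + a ≡ a * n
    lemma (suc k) = trans (+-comm (a * k) a) (sym (*-suc a k))

  ⊕-injectiveˡ : ∀ a → Injective _≡_ _≡_ (λ (x : Fin n) → x ⊕ + a)
  ⊕-injectiveˡ a = strictlySurjective⇒injective (⊕-strictlySurjective a)

  ⊕-injectiveʳ : ∀ (x : Fin n) {a b} → a < n → b < n → x ⊕ + a ≡ x ⊕ + b → a ≡ b
  ⊕-injectiveʳ x {a} {b} a<n b<n eq = begin
    a                ≡⟨ toℕ-fromℕ< a<n ⟨
    toℕ (fromℕ< a<n) ≡⟨ cong toℕ (⊕-injectiveˡ (toℕ x) eq′) ⟩
    toℕ (fromℕ< b<n) ≡⟨ toℕ-fromℕ< b<n ⟩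
    b                ∎
    where
    open ≡-Reasoning
    swap : ∀ {c} (c<n : c < n) → fromℕ< c<n ⊕ + toℕ x ≡ x ⊕ + c
    swap {c} c<n = toℕ-injective (begin
      toℕ (fromℕ< c<n ⊕ + toℕ x)     ≡⟨ toℕ-⊕ (fromℕ< c<n) (toℕ x) ⟩
      (toℕ (fromℕ< c<n) + toℕ x) % n ≡⟨ cong (λ k → (k + toℕ x) % n) (toℕ-fromℕ< c<n) ⟩
      (c + toℕ x) % n                ≡⟨ cong (_% n) (+-comm c (toℕ x)) ⟩
      (toℕ x + c) % n                ≡⟨ toℕ-⊕ x c ⟨
      toℕ (x ⊕ + c)                  ∎)
    eq′ : fromℕ< a<n ⊕ + toℕ x ≡ fromℕ< b<n ⊕ + toℕ x
    eq′ = trans (swap a<n) (trans eq (sym (swap b<n)))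

-- Developing a walk that meets every class of arcs.

module _ (r : ℕ) .{{_ : NonZero r}} where

  private
    instance
      4r≢0 : NonZero (4 * r)
      4r≢0 = m*n≢0 4 r

  layer : Fin (4 * r) → Fin 4
  layer x = toℕ x mod 4

  toℕ-layer : ∀ x → toℕ (layer x) ≡ toℕ x % 4
  toℕ-layer x = toℕ-fromℕ< _

  layer-⊕4 : ∀ x k → layer (x ⊕ + (4 * k)) ≡ layer x
  layer-⊕4 x k = toℕ-injective (begin
    toℕ (layer (x ⊕ + (4 * k)))   ≡⟨ toℕ-layer (x ⊕ + (4 * k)) ⟩
    toℕ (x ⊕ + (4 * k)) % 4       ≡⟨ cong (_% 4) (toℕ-⊕ x (4 * k)) ⟩
    (toℕ x + 4 * k) % (4 * r) % 4 ≡⟨ m∣n⇒o%n%m≡o%m 4 (4 * r) _ (m∣m*n r) ⟩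
    (toℕ x + 4 * k) % 4           ≡⟨ cong (λ m → (toℕ x + m) % 4) (*-comm 4 k) ⟩
    (toℕ x + k * 4) % 4           ≡⟨ [m+kn]%n≡m%n (toℕ x) k 4 ⟩
    toℕ x % 4                     ≡⟨ toℕ-layer x ⟨
    toℕ (layer x)                 ∎)
    where open ≡-Reasoning

  -- The two vertices have the same remainder modulo 4, so their difference is 4 times the
  -- difference of their quotients, taken modulo `r`.
  ⊕4-transitive : ∀ t x → layer t ≡ layer x → ∃[ i ] t ⊕ + (4 * toℕ {r} i) ≡ x
  ⊕4-transitive t x eq = from (≤-total t₄ x₄)
    where
    open ≡-Reasoning
    t₄ = toℕ t div 4
    x₄ = toℕ x div 4

    quot<r : ∀ y → toℕ {4 * r} y div 4 < r
    quot<r y = m<n*o⇒m/o<n (subst (toℕ y <_) (*-comm 4 r) (toℕ<n y))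

    ρ : toℕ t % 4 ≡ toℕ x % 4
    ρ = trans (sym (toℕ-layer t)) (trans (cong toℕ eq) (toℕ-layer x))

    -- `k` counts the turns around the `r` vertices of the layer: 0 if `t₄ ≤ x₄`, otherwise 1.
    result : ∀ {i} k (i<r : i < r) → t₄ + i ≡ x₄ + k * r → ∃[ i ] t ⊕ + (4 * toℕ {r} i) ≡ x
    result {i} k i<r t₄+i = fromℕ< i<r , toℕ-injective (begin
      toℕ (t ⊕ + (4 * toℕ (fromℕ< i<r)))           ≡⟨ toℕ-⊕ t _ ⟩
      (toℕ t + 4 * toℕ (fromℕ< i<r)) % (4 * r)     ≡⟨ cong₂ (λ a b → (a + 4 * b) % (4 * r)) (m≡m%n+[m/n]*n (toℕ t) 4) (toℕ-fromℕ< i<r) ⟩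
      (toℕ t % 4 + t₄ * 4 + 4 * i) % (4 * r)       ≡⟨ cong (_% (4 * r)) (lemma₁ (toℕ t % 4) t₄ i) ⟩
      (toℕ t % 4 + (t₄ + i) * 4) % (4 * r)         ≡⟨ cong₂ (λ a b → (a + b * 4) % (4 * r)) ρ t₄+i ⟩
      (toℕ x % 4 + (x₄ + k * r) * 4) % (4 * r)     ≡⟨ cong (_% (4 * r)) (lemma₂ (toℕ x % 4) x₄ k r) ⟩
      (toℕ x % 4 + x₄ * 4 + k * (4 * r)) % (4 * r) ≡⟨ [m+kn]%n≡m%n _ k (4 * r) ⟩
      (toℕ x % 4 + x₄ * 4) % (4 * r)               ≡⟨ cong (_% (4 * r)) (m≡m%n+[m/n]*n (toℕ x) 4) ⟨
      toℕ x % (4 * r)                              ≡⟨ m<n⇒m%n≡m (toℕ<n x) ⟩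
      toℕ x                                        ∎)
      where
      lemma₁ : ∀ a b c → a + b * 4 + 4 * c ≡ a + (b + c) * 4
      lemma₁ = solve-∀
      lemma₂ : ∀ a b k r → a + (b + k * r) * 4 ≡ a + b * 4 + k * (4 * r)
      lemma₂ = solve-∀

    from : t₄ ≤ x₄ ⊎ x₄ ≤ t₄ → ∃[ i ] t ⊕ + (4 * toℕ {r} i) ≡ x
    from (inj₁ t₄≤x₄) = result 0 (≤-<-trans (m∸n≤m x₄ t₄) (quot<r x))
      (trans (m+[n∸m]≡n t₄≤x₄) (sym (+-identityʳ x₄)))
    from (inj₂ x₄≤t₄) with m≤n⇒m<n∨m≡n x₄≤t₄
    -- Equal quotients belong to the first case, since the shift `r ∸ t₄ + x₄` would be `r` here and
    -- not below it.
    ... | inj₂ x₄≡t₄ = from (inj₁ (≤-reflexive (sym x₄≡t₄)))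
    ... | inj₁ x₄<t₄ = result 1 (∸-<ˡ x₄<t₄ (<⇒≤ (quot<r t)))
      (trans (lemma (<⇒≤ (quot<r t))) (cong (λ k → x₄ + k) (sym (+-identityʳ r))))
      where
      ∸-<ˡ : x₄ < t₄ → t₄ ≤ r → r ∸ t₄ + x₄ < r
      ∸-<ˡ x₄<t₄ t₄≤r = subst (r ∸ t₄ + x₄ <_) (m∸n+n≡m t₄≤r) (+-monoʳ-< (r ∸ t₄) x₄<t₄)
      lemma : t₄ ≤ r → t₄ + (r ∸ t₄ + x₄) ≡ x₄ + r
      lemma t₄≤r = trans (sym (+-assoc t₄ (r ∸ t₄) x₄)) (trans (cong (_+ x₄) (m+[n∸m]≡n t₄≤r)) (+-comm r x₄))

  DevelopedStarter : Set
  DevelopedStarter = Σ[ H ∈ Vector (Arc 4 r) (4 * r) ]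
        ( IsBalancedStarter H
        × IsHamiltonDecomposition (λ (i : Fin r) → H +ᴴ + (4 * toℕ i))
        × (∀ (i : Fin r) → ω (H +ᴴ + (4 * toℕ i)) ≡ + (r + 1) / 2))

  module _ (H : Vector (Arc 4 r) (4 * r))
           (closed : IsClosedWalk H)
           (tail-surjective : StrictlySurjective _≡_ (tail ∘ H))
           (class-surjective : ∀ j s → ∃[ i ] layer (tail (H i)) ≡ j × stepIndex (H i) ≡ s) where

    tail-injective : Injective _≡_ _≡_ (tail ∘ H)
    tail-injective = strictlySurjective⇒injective tail-surjective

    -- The pair (layer of the tail, step) is coded in `Fin (4 * r)`, the index set of the walk, so
    -- that the pigeonhole for self-maps applies.
    class : Fin (4 * r) → Fin (4 * r)
    class i = combine (layer (tail (H i))) (stepIndex (H i))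

    class-strictlySurjective : StrictlySurjective _≡_ class
    class-strictlySurjective k
      with j , s , refl ← combine-surjective {4} {r} k
      with i , refl , refl ← class-surjective j s = i , refl

    class-injective : Injective _≡_ _≡_ class
    class-injective = strictlySurjective⇒injective class-strictlySurjective

    translate-isHamiltonCycle : ∀ c → IsHamiltonCycle (H +ᴴ + c)
    translate-isHamiltonCycle c = closed′ , injective , strictlySurjective⇒surjective surjective
      where
      closed′ : IsClosedWalk (H +ᴴ + c)
      closed′ i = trans (⊕-comm (tail (H i)) c (step (H i))) (cong (_⊕ + c) (closed i))

      injective : Injective _≡_ _≡_ (tail ∘ (H +ᴴ + c))
      injective = tail-injective ∘ ⊕-injectiveˡ c

      surjective : StrictlySurjective _≡_ (tail ∘ (H +ᴴ + c))
      surjective y with x , refl ← ⊕-strictlySurjective c y with i , refl ← tail-surjective x = i , refl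

    isBalancedStarter : IsBalancedStarter H
    isBalancedStarter = (closed , tail-injective , strictlySurjective⇒surjective tail-surjective) , balanced
      where
      balanced : ∀ (j : Fin 4) (s : Fin r) →
        ∃! _≡_ λ e → e ∈ᵃ H × stepIndex e ≡ s × toℕ (tail e) % 4 ≡ toℕ j
      balanced j s with i , refl , refl ← class-surjective j s =
        H i , ((i , refl) , refl , sym (toℕ-layer (tail (H i)))) ,
        λ { {_} ((i′ , refl) , s≡ , j≡) → cong H (class-injective
          (cong₂ combine (sym (toℕ-injective (trans (toℕ-layer (tail (H i′))) j≡))) (sym s≡))) }

    -- Translation by a multiple of 4 preserves the class of an arc. So an arc can only come from
    -- the one arc of `H` in its class, and the shift is determined because it is below `4 * r`.
    isHamiltonDecomposition : IsHamiltonDecomposition (λ (i : Fin r) → H +ᴴ + (4 * toℕ i))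
    isHamiltonDecomposition = (λ i → translate-isHamiltonCycle (4 * toℕ i)) , covered
      where
      covered : ∀ e → ∃! _≡_ λ (i : Fin r) → e ∈ᵃ H +ᴴ + (4 * toℕ i)
      covered (arc x s)
        with a , layer≡ , refl ← class-surjective (layer x) s
        with i , refl ← ⊕4-transitive (tail (H a)) x layer≡ =
        i , (a , refl) , unique
        where
        unique : ∀ {i′} → arc (tail (H a) ⊕ + (4 * toℕ i)) (stepIndex (H a)) ∈ᵃ H +ᴴ + (4 * toℕ i′) → i ≡ i′
        unique {i′} (a′ , eq) with refl ← class-injective {a} {a′} (cong₂ combine
            (trans layer≡ (trans (cong layer (sym (cong tail eq))) (layer-⊕4 (tail (H a′)) (toℕ i′))))
            (sym (cong stepIndex eq))) =
          toℕ-injective (*-cancelˡ-≡ (toℕ i) (toℕ i′) 4 (⊕-injectiveʳ (tail (H a))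
            (*-monoʳ-< 4 (toℕ<n i)) (*-monoʳ-< 4 (toℕ<n i′)) (sym (cong tail eq))))

    -- `class` is a permutation, so the sum may run over all pairs (layer, step) instead of the arcs
    -- of `H`.
    ∑-step : ∑ (step ∘ H) ≡ 4 * ∑ (suc ∘ toℕ {r})
    ∑-step = begin
      ∑ (step ∘ H)                    ≡⟨ sum-cong-≗ +-0-monoid (λ i → cong (suc ∘ toℕ ∘ proj₂)
                                           (sym (remQuot-combine (layer (tail (H i))) (stepIndex (H i))))) ⟩
      ∑ (stepOf ∘ class)              ≡⟨ sum-permute +-0-commutativeMonoid stepOf
                                           (⤖⇒↔ (mk⤖ (class-injective , strictlySurjective⇒surjective class-strictlySurjective))) ⟨
      ∑ stepOf              ≡⟨ ∑-combine 4 stepOf (suc ∘ toℕ) (λ j s → cong (suc ∘ toℕ ∘ proj₂) (remQuot-combine {4} {r} j s)) ⟩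
      4 * ∑ (suc ∘ toℕ {r}) ∎
      where
      open ≡-Reasoning
      stepOf : Vector ℕ (4 * r)
      stepOf = suc ∘ toℕ ∘ proj₂ ∘ remQuot {4} r

    ω-translate : ∀ c → ω (H +ᴴ + c) ≡ + (r + 1) / 2
    -- Translation leaves every step unchanged, so the sum for the translate is the sum for `H` by
    -- definition.
    ω-translate c = /-cross (∑ (step ∘ H)) (4 * r) (r + 1) 2 (begin
      ∑ (step ∘ H) * 2            ≡⟨ cong (_* 2) ∑-step ⟩
      4 * ∑ (suc ∘ toℕ {r}) * 2   ≡⟨ lemma₁ (∑ (suc ∘ toℕ {r})) ⟩
      4 * (2 * ∑ (suc ∘ toℕ {r})) ≡⟨ cong (4 *_) (2*∑suc∘toℕ r) ⟩
      4 * (r * (r + 1))           ≡⟨ lemma₂ r ⟩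
      (r + 1) * (4 * r)           ∎)
      where
      open ≡-Reasoning
      lemma₁ : ∀ s → 4 * s * 2 ≡ 4 * (2 * s)
      lemma₁ = solve-∀
      lemma₂ : ∀ r → 4 * (r * (r + 1)) ≡ (r + 1) * (4 * r)
      lemma₂ = solve-∀

-- Walks given as lists of arcs.

toℕ-next : ∀ {m} (i : Fin m) →
  toℕ (next i) ≡ suc (toℕ i) ⊎ (toℕ (next i) ≡ 0 × suc (toℕ i) ≡ m)
toℕ-next {suc m} i with m≤n⇒m<n∨m≡n (toℕ<n i)
... | inj₁ i+1<m = inj₁ (trans (toℕ-fromℕ< _) (m<n⇒m%n≡m i+1<m))
... | inj₂ i+1≡m = inj₂ (trans (toℕ-fromℕ< _) (trans (cong (_% suc m) i+1≡m) (n%n≡0 (suc m))) , i+1≡m)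

-- (x , w) stands for the arc with tail x and step 1 + w.
ArcList : Set
ArcList = List (ℕ × ℕ)

module _ (n : ℕ) .{{_ : NonZero n}} where

  -- Consecutive arcs need only match modulo `n`, so heads are never reduced and pieces can be
  -- concatenated freely.
  Walk : ℕ → ArcList → ℕ → Set
  Walk x []            y = x % n ≡ y % n
  Walk x ((t , w) ∷ l) y = x % n ≡ t % n × Walk (t + suc w) l y

  walk-congˡ : ∀ l {x x′ y} → x % n ≡ x′ % n → Walk x′ l y → Walk x l y
  walk-congˡ []      x≡x′ x′≡y       = trans x≡x′ x′≡y
  walk-congˡ (_ ∷ _) x≡x′ (x′≡t , v) = trans x≡x′ x′≡t , v

  walk-++ : ∀ l {l′ x y z} → Walk x l y → Walk y l′ z → Walk x (l ++ l′) z
  walk-++ []      {l′} x≡y       w = walk-congˡ l′ x≡y w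
  walk-++ (_ ∷ l)      (x≡t , v) w = x≡t , walk-++ l v w

  tailAt headAt : (l : ArcList) → Fin (length l) → ℕ
  tailAt l i = proj₁ (lookup l i)
  headAt l i = proj₁ (lookup l i) + suc (proj₂ (lookup l i))

  walk-first : ∀ l {x y} → Walk x l y → ∀ i → toℕ i ≡ 0 → x % n ≡ tailAt l i % n
  walk-first (_ ∷ _) (x≡t , _) zero _ = x≡t

  walk-last : ∀ l {x y} → Walk x l y → ∀ i → suc (toℕ i) ≡ length l → headAt l i % n ≡ y % n
  walk-last (_ ∷ [])    (_ , v) zero    _  = v
  walk-last (_ ∷ _ ∷ _) (_ , v) (suc i) eq = walk-last (_ ∷ _) v i (suc-injective eq)

  walk-step : ∀ l {x y} → Walk x l y → ∀ i i′ → toℕ i′ ≡ suc (toℕ i) → headAt l i % n ≡ tailAt l i′ % n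
  walk-step (_ ∷ l) (_ , v) zero    (suc i′) eq = walk-first l v i′ (suc-injective eq)
  walk-step (_ ∷ l) (_ , v) (suc i) (suc i′) eq = walk-step l v i i′ (suc-injective eq)

module _ {r : ℕ} .{{_ : NonZero r}} where

  private
    instance
      4r≢0 : NonZero (4 * r)
      4r≢0 = m*n≢0 4 r

  module _ (l : ArcList) (len : 4 * r ≡ length l) {x₀ : ℕ}
           (walk : Walk (4 * r) x₀ l x₀)
           (bounded : All (λ a → proj₂ a < r) l)
           (tails : ∀ {x} → x < 4 * r → ∃[ w ] (x , w) ∈ l)
           (classes : ∀ (j : Fin 4) {w} → w < r → ∃[ x ] x % 4 ≡ toℕ j × (x , w) ∈ l) where

    arcOf : ℕ × ℕ → Arc 4 r
    arcOf (x , w) = arc (x mod (4 * r)) (w mod r)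

    H : Vector (Arc 4 r) (4 * r)
    H i = arcOf (lookup l (cast len i))

    toℕ-head : ∀ {x w} → w < r → toℕ (head (arcOf (x , w))) ≡ (x + suc w) % (4 * r)
    toℕ-head {x} {w} w<r = begin
      toℕ (head (arcOf (x , w)))                            ≡⟨ toℕ-⊕ (x mod (4 * r)) _ ⟩
      (toℕ (x mod (4 * r)) + suc (toℕ (w mod r))) % (4 * r) ≡⟨ cong₂ (λ a b → (a + suc b) % (4 * r)) (toℕ-fromℕ< _)
                                                                  (trans (toℕ-fromℕ< _) (m<n⇒m%n≡m w<r)) ⟩
      (x % (4 * r) + suc w) % (4 * r) ≡⟨ %-absorbˡ x (suc w) (4 * r) ⟩
      (x + suc w) % (4 * r)           ∎
      where open ≡-Reasoning

    closed : IsClosedWalk H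
    closed i = toℕ-injective (trans (toℕ-head (All.lookup bounded (∈-lookup k)))
      (trans (link (toℕ-next i)) (sym (toℕ-fromℕ< _))))
      where
      k k′ : Fin (length l)
      k  = cast len i
      k′ = cast len (next i)

      link : toℕ (next i) ≡ suc (toℕ i) ⊎ (toℕ (next i) ≡ 0 × suc (toℕ i) ≡ 4 * r) →
             headAt (4 * r) l k % (4 * r) ≡ tailAt (4 * r) l k′ % (4 * r)
      link (inj₁ eq) = walk-step (4 * r) l walk k k′
        (trans (toℕ-cast len (next i)) (trans eq (cong suc (sym (toℕ-cast len i)))))
      -- The cycle closes because the list leads from `x₀` back to `x₀`.
      link (inj₂ (eq₀ , eq)) = trans
        (walk-last (4 * r) l walk k (trans (cong suc (toℕ-cast len i)) (trans eq len)))
        (walk-first (4 * r) l walk k′ (trans (toℕ-cast len (next i)) eq₀))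

    H-index : ∀ {a} (a∈l : a ∈ l) → H (cast (sym len) (index a∈l)) ≡ arcOf a
    H-index a∈l = cong arcOf (trans
      (cong (lookup l) (toℕ-injective (trans (toℕ-cast len _) (toℕ-cast (sym len) (index a∈l)))))
      (sym (lookup-index a∈l)))

    tail-surjective : StrictlySurjective _≡_ (tail ∘ H)
    tail-surjective x with w , x∈l ← tails (toℕ<n x) =
      _ , trans (cong tail (H-index x∈l)) (toℕ-injective (trans (toℕ-fromℕ< _) (m<n⇒m%n≡m (toℕ<n x))))

    class-surjective : ∀ j s → ∃[ i ] layer r (tail (H i)) ≡ j × stepIndex (H i) ≡ s
    class-surjective j s with x , x%4≡j , x∈l ← classes j (toℕ<n s) =
      cast (sym len) (index x∈l) ,
      toℕ-injective (begin
        toℕ (layer r (tail (H _)))    ≡⟨ cong (toℕ ∘ layer r ∘ tail) (H-index x∈l) ⟩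
        toℕ (layer r (x mod (4 * r))) ≡⟨ toℕ-layer r (x mod (4 * r)) ⟩
        toℕ (x mod (4 * r)) % 4       ≡⟨ cong (_% 4) (toℕ-fromℕ< (m%n<n x (4 * r))) ⟩
        x % (4 * r) % 4               ≡⟨ m∣n⇒o%n%m≡o%m 4 (4 * r) x (m∣m*n r) ⟩
        x % 4                         ≡⟨ x%4≡j ⟩
        toℕ j                         ∎) ,
      trans (cong stepIndex (H-index x∈l)) (toℕ-injective (trans (toℕ-fromℕ< _) (m<n⇒m%n≡m (toℕ<n s))))
      where
      open ≡-Reasoning

    from-walk : DevelopedStarter r
    from-walk = H , isBalancedStarter r H closed tail-surjective class-surjective ,
      isHamiltonDecomposition r H closed tail-surjective class-surjective ,
      λ i → ω-translate r H closed tail-surjective class-surjective (4 * toℕ i)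

-- Linear forms and symbolic walks.

-- (a , b , c) is the polynomial a m + b m′ + c.  In round m of a run, m′ is the number of rounds still to
-- come, so L = m + 1 + m′ is a form as well and no truncated subtraction occurs.
Form : Set
Form = ℕ × ℕ × ℕ

⟦_⟧ : Form → ℕ → ℕ → ℕ
⟦ a , b , c ⟧ m m′ = a * m + b * m′ + c

infixl 6 _⊞_
_⊞_ : Form → Form → Form
(a , b , c) ⊞ (a′ , b′ , c′) = a + a′ , b + b′ , c + c′

⟦⟧-⊞ : ∀ F G m m′ → ⟦ F ⊞ G ⟧ m m′ ≡ ⟦ F ⟧ m m′ + ⟦ G ⟧ m m′
⟦⟧-⊞ (a , b , c) (a′ , b′ , c′) m m′ = lemma a b c a′ b′ c′ m m′
  where
  lemma : ∀ a b c a′ b′ c′ m m′ → (a + a′) * m + (b + b′) * m′ + (c + c′) ≡ (a * m + b * m′ + c) + (a′ * m + b′ * m′ + c′)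
  lemma = solve-∀

_≟ᶠ_ : DecidableEquality Form
_≟ᶠ_ = ≡-dec _≟_ (≡-dec _≟_ _≟_)

-- An arc with tail j + 4 quotient and step 1 + predStep.
record Entry : Set where
  constructor entry
  field
    layerOf    : Fin 4
    quotient   : Form
    predStep   : Form

open Entry

-- The tail as one linear form, for comparison with heads; `at` instead keeps the shape of a
-- division by 4 with remainder.
tailForm : Entry → Form
tailForm e = let a , b , c = quotient e in 4 * a , 4 * b , toℕ (layerOf e) + 4 * c

at : ℕ → ℕ → Entry → ℕ × ℕ
at m m′ e = toℕ (layerOf e) + ⟦ quotient e ⟧ m m′ * 4 , ⟦ predStep e ⟧ m m′

⟦tailForm⟧ : ∀ e m m′ → ⟦ tailForm e ⟧ m m′ ≡ proj₁ (at m m′ e)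
⟦tailForm⟧ (entry j (a , b , c) _) m m′ = lemma (toℕ j) a b c m m′
  where
  lemma : ∀ j a b c m m′ → 4 * a * m + 4 * b * m′ + (j + 4 * c) ≡ j + (a * m + b * m′ + c) * 4
  lemma = solve-∀

infix 4 _≋_[_]
-- At most one subtraction of the modulus is allowed: with tails below `4 * r` and steps at most
-- `r`, a head passes 0 at most once.
_≋_[_] : Form → Form → Form → Set
F ≋ G [ μ ] = F ≡ G ⊎ F ≡ G ⊞ μ

WalkForm : Form → Form → List Entry → Form → Set
WalkForm μ F []       G = F ≋ G [ μ ]
WalkForm μ F (e ∷ es) G = F ≋ tailForm e [ μ ] × WalkForm μ (tailForm e ⊞ (0 , 0 , 1) ⊞ predStep e) es G

walkForm? : ∀ μ F es G → Dec (WalkForm μ F es G)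
walkForm? μ F []       G = (F ≟ᶠ G) ⊎-dec (F ≟ᶠ (G ⊞ μ))
walkForm? μ F (e ∷ es) G = ((F ≟ᶠ tailForm e) ⊎-dec (F ≟ᶠ (tailForm e ⊞ μ))) ×-dec walkForm? μ _ es G

module _ {n : ℕ} .{{_ : NonZero n}} {μ : Form} (m m′ : ℕ) (n≡ : n ≡ ⟦ μ ⟧ m m′) where

  ≋-sound : ∀ F G → F ≋ G [ μ ] → ⟦ F ⟧ m m′ % n ≡ ⟦ G ⟧ m m′ % n
  ≋-sound F G (inj₁ refl) = refl
  ≋-sound F G (inj₂ refl) = begin
    ⟦ G ⊞ μ ⟧ m m′ % n            ≡⟨ cong (_% n) (⟦⟧-⊞ G μ m m′) ⟩
    (⟦ G ⟧ m m′ + ⟦ μ ⟧ m m′) % n ≡⟨ cong (λ k → (⟦ G ⟧ m m′ + k) % n) n≡ ⟨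
    (⟦ G ⟧ m m′ + n) % n          ≡⟨ [m+n]%n≡m%n (⟦ G ⟧ m m′) n ⟩
    ⟦ G ⟧ m m′ % n                ∎
    where open ≡-Reasoning

  walkForm-sound : ∀ F es G → WalkForm μ F es G → Walk n (⟦ F ⟧ m m′) (map (at m m′) es) (⟦ G ⟧ m m′)
  walkForm-sound F []       G F≋G       = ≋-sound F G F≋G
  walkForm-sound F (e ∷ es) G (F≋e , v) =
    trans (≋-sound F (tailForm e) F≋e) (cong (_% n) (⟦tailForm⟧ e m m′)) ,
    walk-congˡ n (map (at m m′) es) (cong (_% n) (begin
      proj₁ (at m m′ e) + suc (⟦ predStep e ⟧ m m′)           ≡⟨ +-suc (proj₁ (at m m′ e)) (⟦ predStep e ⟧ m m′) ⟩
      suc (proj₁ (at m m′ e) + ⟦ predStep e ⟧ m m′)           ≡⟨ cong (_+ ⟦ predStep e ⟧ m m′) (+-comm (proj₁ (at m m′ e)) 1) ⟨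
      proj₁ (at m m′ e) + 1 + ⟦ predStep e ⟧ m m′             ≡⟨ cong (λ k → k + 1 + ⟦ predStep e ⟧ m m′) (⟦tailForm⟧ e m m′) ⟨
      ⟦ tailForm e ⟧ m m′ + 1 + ⟦ predStep e ⟧ m m′           ≡⟨ cong (_+ ⟦ predStep e ⟧ m m′) (⟦⟧-⊞ (tailForm e) (0 , 0 , 1) m m′) ⟨
      ⟦ tailForm e ⊞ (0 , 0 , 1) ⟧ m m′ + ⟦ predStep e ⟧ m m′ ≡⟨ ⟦⟧-⊞ (tailForm e ⊞ (0 , 0 , 1)) (predStep e) m m′ ⟨
      ⟦ tailForm e ⊞ (0 , 0 , 1) ⊞ predStep e ⟧ m m′          ∎))
      (walkForm-sound _ es G v)
    where open ≡-Reasoning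

-- Iterating one round of a run.

periods : List Entry → ℕ → ℕ → ArcList
periods es m zero     = []
periods es m (suc m′) = map (at m m′) es ++ periods es (suc m) m′

length-periods : ∀ es m L → length (periods es m L) ≡ L * length es
length-periods es m zero    = refl
length-periods es m (suc L) = trans (length-++ (map (at m L) es))
  (cong₂ _+_ (length-map (at m L) es) (length-periods es (suc m) L))

∈-periods : ∀ {e es} → e ∈ es → ∀ m₀ m m′ → at (m₀ + m) m′ e ∈ periods es m₀ (m + suc m′)
∈-periods e∈es m₀ zero    m′ rewrite +-identityʳ m₀ = ∈-++⁺ˡ (∈-map⁺ (at m₀ m′) e∈es)
∈-periods e∈es m₀ (suc m) m′ rewrite +-suc m₀ m = ∈-++⁺ʳ _ (∈-periods e∈es (suc m₀) m m′)

All-periods : ∀ {P : ℕ × ℕ → Set} es m₀ L → (∀ m m′ → m + suc m′ ≡ m₀ + L → All P (map (at m m′) es)) → All P (periods es m₀ L)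
All-periods es m₀ zero    p = []
All-periods es m₀ (suc L) p = All.++⁺ (p m₀ L refl) (All-periods es (suc m₀) L λ m m′ eq → p m m′ (trans eq (sym (+-suc m₀ L))))

-- A period starts at the value of (a , b , c) at (m , suc m′) and ends at its value at (suc m , m′).
IsPeriod : ℕ → Form → List Entry → Set
IsPeriod N (a , b , c) es = WalkForm (32 , 32 , 32 + N) (a , b , b + c) es (a , b , a + c)

isPeriod? : ∀ N F es → Dec (IsPeriod N F es)
isPeriod? N (a , b , c) es = walkForm? (32 , 32 , 32 + N) (a , b , b + c) es (a , b , a + c)

module _ {n : ℕ} .{{_ : NonZero n}} {N : ℕ} where

  -- Induction on the rounds still to come. The sum `m + L` stays fixed, and with it the modulus;
  -- the end of one round is the start of the next.
  periods-walk : ∀ F es → IsPeriod N F es → ∀ m L → n ≡ 32 * (m + L) + N →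
    Walk n (⟦ F ⟧ m L) (periods es m L) (⟦ F ⟧ (m + L) 0)
  periods-walk F es p m zero    n≡ = cong (λ k → ⟦ F ⟧ k 0 % n) (sym (+-identityʳ m))
  periods-walk F@(a , b , c) es p m (suc m′) n≡ =
    walk-congˡ n (periods es m (suc m′)) (cong (_% n) (before a b c m m′))
      (walk-++ n (map (at m m′) es)
        (walkForm-sound m m′ (trans n≡ (modulus m m′ N)) (a , b , b + c) es (a , b , a + c) p)
        (walk-congˡ n (periods es (suc m) m′) (cong (_% n) (after a b c m m′))
          (subst (λ k → Walk n (⟦ F ⟧ (suc m) m′) (periods es (suc m) m′) (⟦ F ⟧ k 0)) (sym (+-suc m m′))
            (periods-walk F es p (suc m) m′ (trans n≡ (cong (λ k → 32 * k + N) (+-suc m m′)))))))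
    where
    before : ∀ a b c m m′ → a * m + b * suc m′ + c ≡ a * m + b * m′ + (b + c)
    before = solve-∀
    after : ∀ a b c m m′ → a * m + b * m′ + (a + c) ≡ a * suc m + b * m′ + c
    after = solve-∀
    modulus : ∀ m m′ N → 32 * (m + suc m′) + N ≡ 32 * m + 32 * m′ + (32 + N)
    modulus = solve-∀

-- Covering an interval by single values and progressions.

Key : Set
Key = Fin 4 × Form

_≟ᵏ_ : DecidableEquality Key
_≟ᵏ_ = ≡-dec Fin._≟_ _≟ᶠ_

open DecMembership _≟ᵏ_ using (_∈?_)

module Tiling (runs extras : List Key) (j : Fin 4) (d c Q U : ℕ) where

  -- The numbers d y + c with q L + u ≤ y < Q L + U are covered by consecutive tiles: single values of
  -- extras, and progressions of length L swept upwards or downwards by a run.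
  data Tiled : ℕ → ℕ → Set where
    done   : Tiled Q U
    single : ∀ {q u} → (j , d * q , 0 , d * u + c) ∈ extras → Tiled q (suc u) → Tiled q u
    up     : ∀ {q u} → (j , d * suc q , d * q , d * (q + u) + c) ∈ runs → Tiled (suc q) u → Tiled q u
    down   : ∀ {q u} → (j , d * q , d * suc q , d * (q + u) + c) ∈ runs → Tiled (suc q) u → Tiled q u

  -- A backtracking search of bounded depth. Only a successful result is used, so completeness is
  -- not at stake.
  tiled? : ℕ → ∀ q u → Maybe (Tiled q u)
  tiled? zero       q u = nothing
  tiled? (suc fuel) q u =
        Maybe.map (λ { (refl , refl) → done }) (dec⇒maybe ((q ≟ Q) ×-dec (u ≟ U)))
    <∣> (dec⇒maybe (_ ∈? extras) >>= λ ∈extras → Maybe.map (single ∈extras) (tiled? fuel q (suc u)))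
    <∣> (dec⇒maybe (_ ∈? runs)   >>= λ ∈runs   → Maybe.map (up ∈runs)       (tiled? fuel (suc q) u))
    <∣> (dec⇒maybe (_ ∈? runs)   >>= λ ∈runs   → Maybe.map (down ∈runs)     (tiled? fuel (suc q) u))

  module _ (L : ℕ) where

    Hit : ℕ → Set
    Hit y = (∃[ F ] (j , F) ∈ extras × ⟦ F ⟧ L 0 ≡ d * y + c)
          ⊎ (∃[ F ] ∃₂ λ m m′ → m + suc m′ ≡ L × (j , F) ∈ runs × ⟦ F ⟧ m m′ ≡ d * y + c)

    Tile : ℕ → ℕ → ℕ → ℕ → Set
    Tile q u q′ u′ = ∀ {y} → q * L + u ≤ y → y < q′ * L + u′ → Hit y

    tile-++ : ∀ {q u q′ u′ q″ u″} → Tile q u q′ u′ → Tile q′ u′ q″ u″ → Tile q u q″ u″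
    tile-++ {q′ = q′} {u′ = u′} before after {y} lo hi with <-≤-connex y (q′ * L + u′)
    ... | inj₁ y< = before lo y<
    ... | inj₂ ≤y = after ≤y hi

    next-start : ∀ q u → suc q * L + u ≡ q * L + u + L
    next-start q u = trans (cong (_+ u) (+-comm L (q * L))) (trans (+-assoc (q * L) L u)
      (trans (cong (λ k → q * L + k) (+-comm L u)) (sym (+-assoc (q * L) u L))))

    offset : ∀ {q u y} → q * L + u ≤ y → y < suc q * L + u →
             ∃₂ λ i i′ → i + suc i′ ≡ L × y ≡ q * L + u + i
    offset {q} {u} {y} lo hi with i , refl ← m≤n⇒∃[o]m+o≡n lo
      with i′ , eq ← m≤n⇒∃[o]m+o≡n (+-cancelˡ-< (q * L + u) i L (subst (q * L + u + i <_) (next-start q u) hi)) =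
      i , i′ , trans (+-suc i i′) eq , refl

    tiled-sound : ∀ {q u} → Tiled q u → Tile q u Q U
    tiled-sound done lo hi = contradiction lo (<⇒≱ hi)
    tiled-sound {q} {u} (single ∈extras t) =
      tile-++ {q} {u} {q} {suc u} {Q} {U}
        (λ {y} lo hi → inj₁ (_ , ∈extras , trans (lemma d q u c L)
          (cong (λ k → d * k + c) (≤-antisym lo (≤-pred (subst (y <_) (+-suc (q * L) u) hi))))))
        (tiled-sound t)
      where
      lemma : ∀ d q u c L → d * q * L + 0 * 0 + (d * u + c) ≡ d * (q * L + u) + c
      lemma = solve-∀
    tiled-sound {q} {u} (up ∈runs t) = tile-++ {q} {u} {suc q} {u} {Q} {U} tile (tiled-sound t)
      where
      -- The summand `d * q` of the constant term accounts for the 1 in `L = i + 1 + i′`.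
      lemma : ∀ d q u c i i′ → d * suc q * i + d * q * i′ + (d * (q + u) + c) ≡ d * (q * (i + suc i′) + u + i) + c
      lemma = solve-∀
      tile : Tile q u (suc q) u
      tile lo hi with i , i′ , refl , refl ← offset {q} {u} lo hi =
        inj₂ (_ , i , i′ , refl , ∈runs , lemma d q u c i i′)
    tiled-sound {q} {u} (down ∈runs t) = tile-++ {q} {u} {suc q} {u} {Q} {U} tile (tiled-sound t)
      where
      lemma : ∀ d q u c i i′ → d * q * i′ + d * suc q * i + (d * (q + u) + c) ≡ d * (q * (i + suc i′) + u + i) + c
      lemma = solve-∀
      tile : Tile q u (suc q) u
      -- A downward sweep reaches offset `i` in round `i′`, with `i` rounds still to come.
      tile lo hi with i , i′ , refl , refl ← offset {q} {u} lo hi =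
        inj₂ (_ , i′ , i , trans (+-comm i′ (suc i)) (sym (+-suc i i′)) , ∈runs , lemma d q u c i i′)

-- Blueprints and their finite conditions.

-- Compares coefficients with those of `r`, which is `8 * (m + m′) + (8 + r₀)` in a round of a run
-- and `8 * L + r₀` for the inherited arcs.
StepBelow : ℕ → Entry → Set
StepBelow K e = let a , b , c = predStep e in a ≤ 8 × b ≤ 8 × c < K

stepBelow? : ∀ K e → Dec (StepBelow K e)
stepBelow? K e = let a , b , c = predStep e in (a ≤? 8) ×-dec (b ≤? 8) ×-dec (c <? K)

stepBelow-sound : ∀ {K e} m m′ → StepBelow K e → proj₂ (at m m′ e) < 8 * (m + m′) + K
stepBelow-sound {K} {e} m m′ (a≤8 , b≤8 , c<K) = subst (proj₂ (at m m′ e) <_)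
  (cong (_+ K) (sym (*-distribˡ-+ 8 m m′)))
  (+-mono-≤-< (+-mono-≤ (*-monoˡ-≤ m a≤8) (*-monoˡ-≤ m′ b≤8)) c<K)

-- For c < 8, the number of y with c + 8 y < r₀.
count8 : ℕ → ℕ → ℕ
count8 r₀ c = (r₀ + 7 ∸ c) div 8

-- The walk consists of L rounds of A, then L rounds of B, then X evaluated at (m , m′) = (L , 0).  The
-- runs start at the values of FA and FB at (0 , L).
record Blueprint : Set where
  field
    r₀      : ℕ
    A B X   : List Entry
    FA FB   : Form

keys : (Entry → Form) → List Entry → List Key
keys f = map λ e → layerOf e , f e

-- The values of a run's form after its last and before its first round, both as forms evaluated at
-- `(L , 0)`.
atEnd atStart : Form → Form
atEnd   (a , b , c) = a , 0 , c
atStart (a , b , c) = b , 0 , c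

module _ (bp : Blueprint) where
  open Blueprint bp

  N : ℕ
  N = 4 * r₀

  -- The `r` quotients in a layer split into 8 progressions, two for each of the four cuts, and `r₀`
  -- inherited values. In `Steps`, each class modulo 8 contains exactly one progression.
  module Tails (j : Fin 4) =
    Tiling (keys quotient (A ++ B)) (keys quotient X) j 1 0 8 r₀
  module Steps (j : Fin 4) (c : Fin 8) =
    Tiling (keys predStep (A ++ B)) (keys predStep X) j 8 (toℕ c) 1 (count8 r₀ (toℕ c))

  TailsTiled StepsTiled : Set
  -- The depth `r₀ + 9` allows 8 progressions, `r₀` single values and `done`. For steps a tiling has
  -- `count8` single values, one progression and `done`, at most `r₀` constructors for both values
  -- of `r₀` used.
  TailsTiled = ∀ j → T (is-just (Tails.tiled? j (r₀ + 9) 0 0))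
  StepsTiled = ∀ j c → T (is-just (Steps.tiled? j c r₀ 0 0))

  tailsTiled? : Dec TailsTiled
  tailsTiled? = Fin.all? λ j → T? _

  stepsTiled? : Dec StepsTiled
  stepsTiled? = Fin.all? λ j → Fin.all? λ c → T? _

  record Valid : Set where
    constructor mkValid
    field
      runs-length   : length A + length B ≡ 32
      extras-length : length X ≡ N
      walkA         : IsPeriod N FA A
      walkB         : IsPeriod N FB B
      walkAB        : WalkForm (32 , 0 , N) (atEnd FA) [] (atStart FB)
      walkX         : WalkForm (32 , 0 , N) (atEnd FB) X (atStart FA)
      runs-below    : All (StepBelow (8 + r₀)) (A ++ B)
      extras-below  : All (StepBelow r₀) X
      tails-tiled   : TailsTiled
      steps-tiled   : StepsTiled

-- With `c = w % 8`, `count8` rounds `(r₀ - c) / 8` up, so `8 * U + c` is at least `r₀`; a quotient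
-- of at least `L + U` would force `w` up to `8 * L + r₀`.
/8<count8 : ∀ L r₀ w → w < 8 * L + r₀ → w div 8 < 1 * L + count8 r₀ (w % 8)
/8<count8 L r₀ w w< = ≰⇒> λ L+U≤y → <⇒≱ w< (begin
  8 * L + r₀              ≤⟨ +-monoʳ-≤ (8 * L) r₀≤ ⟩
  8 * L + (8 * U + w % 8) ≡⟨ lemma L U (w % 8) ⟩
  w % 8 + (1 * L + U) * 8 ≤⟨ +-monoʳ-≤ (w % 8) (*-monoˡ-≤ 8 L+U≤y) ⟩
  w % 8 + w div 8 * 8     ≡⟨ m≡m%n+[m/n]*n w 8 ⟨
  w                       ∎)
  where
  open ≤-Reasoning
  lemma : ∀ L U c → 8 * L + (8 * U + c) ≡ c + (1 * L + U) * 8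
  lemma = solve-∀
  lemma′ : ∀ U c → c + (7 + U * 8) ≡ 7 + (8 * U + c)
  lemma′ = solve-∀
  k U : ℕ
  k = r₀ + 7 ∸ w % 8
  U = count8 r₀ (w % 8)
  r₀≤ : r₀ ≤ 8 * U + w % 8
  -- The 7 added on both sides absorbs the remainder `k % 8`.
  r₀≤ = +-cancelˡ-≤ 7 r₀ (8 * U + w % 8) (begin
    7 + r₀                  ≡⟨ +-comm 7 r₀ ⟩
    r₀ + 7                  ≤⟨ m≤n+m∸n (r₀ + 7) (w % 8) ⟩
    w % 8 + k               ≡⟨ cong (λ x → w % 8 + x) (m≡m%n+[m/n]*n k 8) ⟩
    w % 8 + (k % 8 + U * 8) ≤⟨ +-monoʳ-≤ (w % 8) (+-monoˡ-≤ (U * 8) (≤-pred (m%n<n k 8))) ⟩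
    w % 8 + (7 + U * 8)     ≡⟨ lemma′ U (w % 8) ⟩
    7 + (8 * U + w % 8)     ∎)

-- From a valid blueprint to a developed starter.

module _ (bp : Blueprint) (valid : Valid bp) (L r : ℕ) .{{_ : NonZero r}} (r≡ : r ≡ 8 * L + Blueprint.r₀ bp) where
  open Blueprint bp
  open Valid valid

  private
    instance
      4r≢0 : NonZero (4 * r)
      4r≢0 = m*n≢0 4 r

  arcs : ArcList
  arcs = (periods A 0 L ++ periods B 0 L) ++ map (at L 0) X

  length-arcs : 4 * r ≡ length arcs
  length-arcs = sym (begin
    length arcs                                                      ≡⟨ length-++ (periods A 0 L ++ periods B 0 L) ⟩
    length (periods A 0 L ++ periods B 0 L) + length (map (at L 0) X)
      ≡⟨ cong₂ _+_ (trans (length-++ (periods A 0 L)) (cong₂ _+_ (length-periods A 0 L) (length-periods B 0 L)))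
                   (trans (length-map (at L 0) X) extras-length) ⟩
    L * length A + L * length B + 4 * r₀ ≡⟨ cong (_+ 4 * r₀) (*-distribˡ-+ L (length A) (length B)) ⟨
    L * (length A + length B) + 4 * r₀   ≡⟨ cong (λ k → L * k + 4 * r₀) runs-length ⟩
    L * 32 + 4 * r₀                      ≡⟨ lemma L r₀ ⟩
    4 * (8 * L + r₀)                     ≡⟨ cong (4 *_) r≡ ⟨
    4 * r                                ∎)
    where
    open ≡-Reasoning
    lemma : ∀ L r₀ → L * 32 + 4 * r₀ ≡ 4 * (8 * L + r₀)
    lemma = solve-∀

  arcs-walk : Walk (4 * r) (⟦ FA ⟧ 0 L) arcs (⟦ FA ⟧ 0 L)
  arcs-walk =
    walk-++ (4 * r) (periods A 0 L ++ periods B 0 L)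
      (walk-++ (4 * r) (periods A 0 L) (periods-walk FA A walkA 0 L 4r≡₀)
        (walk-congˡ (4 * r) (periods B 0 L) junction (periods-walk FB B walkB 0 L 4r≡₀)))
      (walk-congˡ (4 * r) (map (at L 0) X) (cong (_% (4 * r)) (end≡ FB))
        (subst (Walk (4 * r) _ (map (at L 0) X)) (sym (start≡ FA))
          (walkForm-sound L 0 4r≡ (atEnd FB) X (atStart FA) walkX)))
    where
    lemma₀ : ∀ L r₀ → 4 * (8 * L + r₀) ≡ 32 * (0 + L) + 4 * r₀
    lemma₀ = solve-∀
    lemma₁ : ∀ L r₀ → 4 * (8 * L + r₀) ≡ 32 * L + 0 * 0 + 4 * r₀
    lemma₁ = solve-∀
    4r≡₀ : 4 * r ≡ 32 * (0 + L) + 4 * r₀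
    4r≡₀ = trans (cong (4 *_) r≡) (lemma₀ L r₀)
    4r≡ : 4 * r ≡ ⟦ 32 , 0 , 4 * r₀ ⟧ L 0
    4r≡ = trans (cong (4 *_) r≡) (lemma₁ L r₀)
    end≡ : ∀ F → ⟦ F ⟧ L 0 ≡ ⟦ atEnd F ⟧ L 0
    end≡ (a , b , c) = cong (λ k → a * L + k + c) (*-zeroʳ b)
    start≡ : ∀ F → ⟦ F ⟧ 0 L ≡ ⟦ atStart F ⟧ L 0
    start≡ (a , b , c) = cong (_+ c) (trans (cong (_+ b * L) (*-zeroʳ a)) (sym (+-identityʳ (b * L))))
    junction : ⟦ FA ⟧ L 0 % (4 * r) ≡ ⟦ FB ⟧ 0 L % (4 * r)
    junction = trans (cong (_% (4 * r)) (end≡ FA)) (trans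
      (walkForm-sound L 0 4r≡ (atEnd FA) [] (atStart FB) walkAB) (cong (_% (4 * r)) (sym (start≡ FB))))

  arcs-bounded : All (λ a → proj₂ a < r) arcs
  arcs-bounded =
    All.++⁺ (All.++⁺ (runs A (All.++⁻ˡ A runs-below)) (runs B (All.++⁻ʳ A runs-below)))
      (All.map⁺ (All.map (λ {e} p → subst (proj₂ (at L 0 e) <_)
        (sym (trans r≡ (cong (λ k → 8 * k + r₀) (sym (+-identityʳ L))))) (stepBelow-sound {e = e} L 0 p)) extras-below))
    where
    lemma : ∀ m m′ r₀ → 8 * (m + suc m′) + r₀ ≡ 8 * (m + m′) + (8 + r₀)
    lemma = solve-∀
    runs : ∀ es → All (StepBelow (8 + r₀)) es → All (λ a → proj₂ a < r) (periods es 0 L)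
    runs es below = All-periods es 0 L λ { m m′ refl → All.map⁺ (All.map (λ {e} p →
      subst (proj₂ (at m m′ e) <_) (sym (trans r≡ (lemma m m′ r₀))) (stepBelow-sound {e = e} m m′ p)) below) }

  ∈-arcs-runs : ∀ {e m m′} → e ∈ A ++ B → m + suc m′ ≡ L → at m m′ e ∈ arcs
  ∈-arcs-runs {m = m} {m′} e∈ refl with ∈-++⁻ A e∈
  ... | inj₁ e∈A = ∈-++⁺ˡ (∈-++⁺ˡ (∈-periods e∈A 0 m m′))
  ... | inj₂ e∈B = ∈-++⁺ˡ (∈-++⁺ʳ (periods A 0 L) (∈-periods e∈B 0 m m′))

  -- Turns a covered number into an actual arc: single values come from `X` at `(L , 0)`,
  -- progressions from a round of `A` or `B`.
  hit : ∀ f j d c y {Q U} → Tiling.Hit (keys f (A ++ B)) (keys f X) j d c Q U L y →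
        ∃[ e ] ∃₂ λ m m′ → at m m′ e ∈ arcs × layerOf e ≡ j × ⟦ f e ⟧ m m′ ≡ d * y + c
  hit f j d c _ (inj₁ (F , F∈ , eq)) with e , e∈ , refl ← ∈-map⁻ _ F∈ =
    e , L , 0 , ∈-++⁺ʳ (periods A 0 L ++ periods B 0 L) (∈-map⁺ (at L 0) e∈) , refl , eq
  hit f j d c _ (inj₂ (F , m , m′ , L≡ , F∈ , eq)) with e , e∈ , refl ← ∈-map⁻ _ F∈ =
    e , m , m′ , ∈-arcs-runs e∈ L≡ , refl , eq

  arcs-tails : ∀ {x} → x < 4 * r → ∃[ w ] (x , w) ∈ arcs
  arcs-tails {x} x<4r
    with e , m , m′ , e∈ , layer≡ , eq ← hit quotient (x mod 4) 1 0 (x div 4) {8} {r₀}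
      (Tails.tiled-sound bp (x mod 4) L
        (to-witness-T (Tails.tiled? bp (x mod 4) (r₀ + 9) 0 0) (tails-tiled (x mod 4))) z≤n
        (subst (x div 4 <_) r≡ (m<n*o⇒m/o<n (subst (x <_) (*-comm 4 r) x<4r)))) =
    _ , subst (λ y → (y , ⟦ predStep e ⟧ m m′) ∈ arcs) (begin
      toℕ (layerOf e) + ⟦ quotient e ⟧ m m′ * 4 ≡⟨ cong₂ (λ j k → toℕ j + k * 4) layer≡ eq ⟩
      toℕ (x mod 4) + (1 * (x div 4) + 0) * 4   ≡⟨ cong₂ (λ j k → j + k * 4) (toℕ-fromℕ< (m%n<n x 4))
                                                      (trans (+-identityʳ _) (*-identityˡ (x div 4))) ⟩
      x % 4 + x div 4 * 4 ≡⟨ m≡m%n+[m/n]*n x 4 ⟨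
      x                   ∎) e∈
    where open ≡-Reasoning

  arcs-classes : ∀ (j : Fin 4) {w} → w < r → ∃[ x ] x % 4 ≡ toℕ j × (x , w) ∈ arcs
  arcs-classes j {w} w<r
    with e , m , m′ , e∈ , refl , eq ← hit predStep j 8 (toℕ (w mod 8)) (w div 8) {1} {count8 r₀ (toℕ (w mod 8))}
      (Steps.tiled-sound bp j (w mod 8) L
        (to-witness-T (Steps.tiled? bp j (w mod 8) r₀ 0 0) (steps-tiled j (w mod 8))) z≤n
        (subst (λ c → w div 8 < 1 * L + count8 r₀ c) (sym (toℕ-fromℕ< (m%n<n w 8)))
          (/8<count8 L r₀ w (subst (w <_) r≡ w<r)))) =
    _ , trans ([m+kn]%n≡m%n (toℕ (layerOf e)) (⟦ quotient e ⟧ m m′) 4) (m<n⇒m%n≡m (toℕ<n (layerOf e))) ,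
    subst (λ k → (proj₁ (at m m′ e) , k) ∈ arcs) (begin
      ⟦ predStep e ⟧ m m′           ≡⟨ eq ⟩
      8 * (w div 8) + toℕ (w mod 8) ≡⟨ cong₂ _+_ (*-comm 8 (w div 8)) (toℕ-fromℕ< (m%n<n w 8)) ⟩
      w div 8 * 8 + w % 8           ≡⟨ +-comm (w div 8 * 8) (w % 8) ⟩
      w % 8 + w div 8 * 8           ≡⟨ m≡m%n+[m/n]*n w 8 ⟨
      w                             ∎) e∈
    where open ≡-Reasoning

  developedStarter : DevelopedStarter r
  developedStarter = from-walk arcs length-arcs arcs-walk arcs-bounded arcs-tails arcs-classes

-- The two blueprints.

-- The first tail of a run whose first entry is rise j p u c, as a form in (m , suc m′).
start : Fin 4 → ℕ → ℕ → Form
start j p u = 4 * suc p , 4 * p , toℕ j + 4 * u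

-- Block number p of layer j, preceded in its layer by u inherited vertices.  Its tails rise (fall) by 4
-- while its steps fall (rise) by 8, ending (starting) at 1 + c.
rise fall : Fin 4 → ℕ → ℕ → ℕ → Entry
rise j p u c = entry j (suc p , p , p + u) (0 , 8 , c)
fall j p u c = entry j (p , suc p , p + u) (8 , 0 , c)

-- The vertex of layer j preceded by p blocks and u inherited vertices, with the step 1 + c + 8 L b.
keep : Fin 4 → ℕ → ℕ → ℕ → ℕ → Entry
keep j p u b c = entry j (p , 0 , u) (8 * b , 0 , c)

-- The two blueprints were found by computer search.
blueprint5 : Blueprint
blueprint5 = record
  { r₀ = 5
  -- `A` and `B` start in the two adjacent blocks at one cut of layer 3. Sweeping the first upwards
  -- ends where the second begins, and sweeping the second ends at the inherited vertex where `X`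
  -- begins.
  ; FA = start 3F 2 1
  ; FB = start 3F 3 1
  -- Block numbers grow by one cyclically: once around the eight in `A`, three times in `B`. From a
  -- rising block to the next, falling one, the quotient grows by `L + m′ - m` plus a constant, that
  -- is by `2 * m′` plus a constant; hence the coefficient 8 of the step.
  ; A  = rise 3F 2 1 2 ∷ fall 2F 3 1 11 ∷ rise 2F 4 3 0 ∷ fall 3F 5 2 7
    ∷ rise 3F 6 3 5 ∷ fall 1F 7 4 7 ∷ rise 1F 0 0 4 ∷ fall 2F 1 0 12 ∷ []
  ; B  = rise 3F 3 1 9 ∷ fall 1F 4 3 2 ∷ rise 0F 5 3 8 ∷ fall 1F 6 4 1
    ∷ rise 3F 7 3 11 ∷ fall 3F 0 0 0 ∷ rise 0F 1 0 9 ∷ fall 2F 2 1 6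
    ∷ rise 1F 3 2 6 ∷ fall 0F 4 3 4 ∷ rise 1F 5 3 8 ∷ fall 2F 6 4 1
    ∷ rise 0F 7 4 7 ∷ fall 0F 0 0 6 ∷ rise 3F 1 0 4 ∷ fall 0F 2 1 3
    ∷ rise 0F 3 1 10 ∷ fall 3F 4 2 6 ∷ rise 2F 5 3 5 ∷ fall 0F 6 4 5
    ∷ rise 2F 7 4 7 ∷ fall 2F 0 0 2 ∷ rise 1F 1 0 11 ∷ fall 1F 2 2 5 ∷ []
  -- Inherited vertices are preceded by an even number of blocks, since blocks are inserted in
  -- pairs.
  ; X  = keep 3F 4 1 1 4 ∷ keep 0F 6 3 1 4 ∷ keep 1F 8 4 0 0 ∷ keep 2F 8 4 1 2
    ∷ keep 1F 2 0 0 3 ∷ keep 1F 2 1 1 2 ∷ keep 0F 4 2 0 0 ∷ keep 1F 4 2 1 4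
    ∷ keep 2F 6 3 1 1 ∷ keep 0F 8 4 1 3 ∷ keep 0F 2 0 0 2 ∷ keep 3F 2 0 1 0
    ∷ keep 0F 4 1 0 1 ∷ keep 2F 4 1 0 3 ∷ keep 2F 4 2 1 0 ∷ keep 3F 6 2 0 1
    ∷ keep 1F 6 3 1 1 ∷ keep 3F 8 3 0 3 ∷ keep 3F 8 4 1 2 ∷ keep 2F 2 0 0 4 ∷ []
  }

blueprint9 : Blueprint
blueprint9 = record
  { r₀ = 9
  ; FA = start 3F 4 4
  ; FB = start 3F 5 4
  ; A  = rise 3F 4 4 2 ∷ fall 2F 5 4 14 ∷ rise 1F 6 7 1 ∷ fall 3F 7 6 15
    ∷ rise 3F 0 0 1 ∷ fall 1F 1 0 15 ∷ rise 1F 2 3 4 ∷ fall 2F 3 3 12 ∷ []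
  ; B  = rise 3F 5 4 14 ∷ fall 2F 6 7 2 ∷ rise 1F 7 7 10 ∷ fall 0F 0 0 5
    ∷ rise 2F 1 0 15 ∷ fall 2F 2 3 0 ∷ rise 3F 3 2 13 ∷ fall 1F 4 5 3
    ∷ rise 1F 5 5 6 ∷ fall 0F 6 6 9 ∷ rise 2F 7 7 11 ∷ fall 2F 0 0 1
    ∷ rise 0F 1 0 15 ∷ fall 0F 2 3 4 ∷ rise 1F 3 3 8 ∷ fall 2F 4 4 5
    ∷ rise 0F 5 5 10 ∷ fall 3F 6 6 0 ∷ rise 0F 7 6 16 ∷ fall 1F 0 0 5
    ∷ rise 3F 1 0 11 ∷ fall 3F 2 2 4 ∷ rise 0F 3 3 11 ∷ fall 0F 4 5 6 ∷ []
  ; X  = keep 3F 6 4 0 6 ∷ keep 2F 6 6 1 0 ∷ keep 3F 8 6 0 7 ∷ keep 3F 8 8 1 1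
    ∷ keep 1F 2 0 0 7 ∷ keep 1F 2 2 1 1 ∷ keep 3F 4 2 0 5 ∷ keep 1F 4 4 1 5
    ∷ keep 3F 6 5 1 0 ∷ keep 0F 8 6 0 8 ∷ keep 1F 8 8 1 4 ∷ keep 2F 2 0 0 7
    ∷ keep 2F 2 2 1 2 ∷ keep 1F 4 3 1 6 ∷ keep 0F 6 5 0 1 ∷ keep 2F 6 5 1 5
    ∷ keep 0F 8 7 0 2 ∷ keep 3F 8 7 1 8 ∷ keep 0F 2 1 0 0 ∷ keep 1F 2 1 0 0
    ∷ keep 2F 2 1 1 8 ∷ keep 3F 4 3 1 2 ∷ keep 2F 6 4 0 6 ∷ keep 1F 6 6 1 3
    ∷ keep 1F 8 7 0 2 ∷ keep 0F 8 8 1 6 ∷ keep 3F 2 0 0 3 ∷ keep 3F 2 1 1 4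
    ∷ keep 0F 4 3 0 3 ∷ keep 0F 4 4 1 4 ∷ keep 1F 6 5 1 8 ∷ keep 2F 8 7 0 3
    ∷ keep 2F 8 8 1 1 ∷ keep 0F 2 0 0 7 ∷ keep 0F 2 2 1 5 ∷ keep 2F 4 3 0 4 ∷ []
  }

-- `L` occurs in none of the fields, so each is settled by evaluating a closed decision procedure or
-- by `refl`.
valid5 : Valid blueprint5
valid5 = mkValid refl refl
  (toWitness {a? = isPeriod? _ (FA blueprint5) (A blueprint5)} _)
  (toWitness {a? = isPeriod? _ (FB blueprint5) (B blueprint5)} _)
  (toWitness {a? = walkForm? _ (atEnd (FA blueprint5)) [] (atStart (FB blueprint5))} _)
  (toWitness {a? = walkForm? _ (atEnd (FB blueprint5)) (X blueprint5) (atStart (FA blueprint5))} _)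
  (toWitness {a? = all? (stepBelow? _) (A blueprint5 ++ B blueprint5)} _)
  (toWitness {a? = all? (stepBelow? _) (X blueprint5)} _)
  (toWitness {a? = tailsTiled? blueprint5} _)
  (toWitness {a? = stepsTiled? blueprint5} _)
  where open Blueprint

valid9 : Valid blueprint9
valid9 = mkValid refl refl
  (toWitness {a? = isPeriod? _ (FA blueprint9) (A blueprint9)} _)
  (toWitness {a? = isPeriod? _ (FB blueprint9) (B blueprint9)} _)
  (toWitness {a? = walkForm? _ (atEnd (FA blueprint9)) [] (atStart (FB blueprint9))} _)
  (toWitness {a? = walkForm? _ (atEnd (FB blueprint9)) (X blueprint9) (atStart (FA blueprint9))} _)
  (toWitness {a? = all? (stepBelow? _) (A blueprint9 ++ B blueprint9)} _)
  (toWitness {a? = all? (stepBelow? _) (X blueprint9)} _)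
  (toWitness {a? = tailsTiled? blueprint9} _)
  (toWitness {a? = stepsTiled? blueprint9} _)
  where open Blueprint

-- Residues modulo 8 and conclusion.

%4≡1⇒8L+5⊎8L+9 : ∀ r → r % 4 ≡ 1 → 9 ≤ r → ∃[ L ] (r ≡ 8 * L + 5 ⊎ r ≡ 8 * L + 9)
%4≡1⇒8L+5⊎8L+9 r r%4≡1 9≤r = split (halve (r div 4))
  where
  halve : ∀ k → ∃[ L ] (k ≡ 2 * L ⊎ k ≡ 1 + 2 * L)
  halve zero    = 0 , inj₁ refl
  halve (suc k) with halve k
  ... | L , inj₁ refl = L , inj₂ refl
  ... | L , inj₂ refl = suc L , inj₁ (sym (*-suc 2 L))
  r≡ : r ≡ 1 + r div 4 * 4
  r≡ = trans (m≡m%n+[m/n]*n r 4) (cong (_+ r div 4 * 4) r%4≡1)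
  lemma₅ : ∀ L → 1 + (1 + 2 * L) * 4 ≡ 8 * L + 5
  lemma₅ = solve-∀
  lemma₉ : ∀ L → 1 + 2 * suc L * 4 ≡ 8 * L + 9
  lemma₉ = solve-∀
  split : ∃[ L ] (r div 4 ≡ 2 * L ⊎ r div 4 ≡ 1 + 2 * L) → ∃[ L ] (r ≡ 8 * L + 5 ⊎ r ≡ 8 * L + 9)
  split (L     , inj₂ eq) = L , inj₁ (trans r≡ (trans (cong (λ k → 1 + k * 4) eq) (lemma₅ L)))
  split (suc L , inj₁ eq) = L , inj₂ (trans r≡ (trans (cong (λ k → 1 + k * 4) eq) (lemma₉ L)))
  -- Quotient 0 means `r = 1`, against `9 ≤ r`.
  split (zero  , inj₁ eq) = contradiction (subst (9 ≤_) (trans r≡ (cong (λ k → 1 + k * 4) eq)) 9≤r) λ { (s≤s ()) }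

theorem4p7 : ∀ (r : ℕ) .{{_ : NonZero r}} → r % 4 ≡ 1 → 9 ≤ r →
    Σ[ H ∈ Vector (Arc 4 r) (4 * r) ]
      ( IsBalancedStarter H
      × IsHamiltonDecomposition (λ (i : Fin r) → H +ᴴ + (4 * toℕ i))
      × (∀ (i : Fin r) → ω (H +ᴴ + (4 * toℕ i)) ≡ + (r + 1) / 2))
theorem4p7 r r%4≡1 9≤r with %4≡1⇒8L+5⊎8L+9 r r%4≡1 9≤r
... | L , inj₁ r≡ = developedStarter blueprint5 valid5 L r r≡
... | L , inj₂ r≡ = developedStarter blueprint9 valid9 L r r≡
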